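{- Let $G$ be a connected Eulerian partial $3$-tree with $n$ vertices. Then $\mathrm{cn}(G)\le \lfloor (n-1)/2\rfloor$.
   Context: All graphs are finite and simple. A graph is Eulerian if all of its vertices have even degree. A cycle decomposition of an Eulerian graph $G$ is a set of pairwise edge-disjoint cycles of $G$ that together cover $E(G)$; $\mathrm{cn}(G)$ is the minimum size of a cycle decomposition of $G$ (it is $0$ if $G$ has no edges). For a positive integer $k$, a graph $G$ is a $k$-tree if either $G\simeq K_k$, or $G$ contains a vertex $v$ such that the subgraph induced by the neighborhood $N(v)$ is isomorphic to $K_k$ and $G-v$ is a $k$-tree. A partial $k$-tree is a subgraph of a $k$-tree. (Partial $k$-trees are exactly the graphs with treewidth at most $k$.) -}

module Defs where

open import Data.Bool using (Bool; false; not; T)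
open import Data.Fin using (Fin; punchIn; _≟_)
open import Data.Fin.Subset using (Subset; _∈_; ∣_∣)
open import Data.List using (List; _∷_; _∷ʳ_; length; zip)
import Data.List.Membership.Propositional as List
open import Data.List.Relation.Unary.AllPairs using (AllPairs)
open import Data.List.Relation.Unary.Any using (Any)
open import Data.List.Relation.Unary.Linked using (Linked)
open import Data.List.Relation.Unary.Unique.Propositional using (Unique)
open import Data.Nat using (ℕ; suc; _≤_)
open import Data.Nat.Divisibility using (_∣_)
open import Data.Product using (Σ-syntax; ∃-syntax; _×_; _,_; proj₁)
open import Data.Sum using (_⊎_)
open import Data.Vec using (tabulate)
open import Function using (_↔_; Inverse; Injective)
open import Relation.Binary.Construct.Closure.ReflexiveTransitive using (Star)
open import Relation.Binary.PropositionalEquality using (_≡_; refl; sym)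
open import Relation.Nullary using (¬_; yes; no; contradiction)
open import Relation.Nullary.Decidable using (⌊_⌋)

record Graph (V : Set) : Set where
  field
    adj        : V → V → Bool
    adj-sym    : ∀ u v → adj u v ≡ adj v u
    adj-irrefl : ∀ v → adj v v ≡ false

  Adj : V → V → Set
  Adj u v = T (adj u v)

open Graph public

K : ∀ k → Graph (Fin k)
K k = record { adj = λ u v → not ⌊ u ≟ v ⌋ ; adj-sym = symm ; adj-irrefl = irr }
  where
  symm : ∀ (u v : Fin k) → not ⌊ u ≟ v ⌋ ≡ not ⌊ v ≟ u ⌋
  symm u v with u ≟ v | v ≟ u
  ... | yes _ | yes _ = refl
  ... | no  _ | no  _ = refl
  ... | yes p | no  q = contradiction (sym p) q
  ... | no  p | yes q = contradiction (sym q) p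

  irr : ∀ (v : Fin k) → not ⌊ v ≟ v ⌋ ≡ false
  irr v with v ≟ v
  ... | yes _ = refl
  ... | no  p = contradiction refl p

infix 4 _≅_ _⊑_
infixl 6 _∖_

_≅_ : ∀ {V W} → Graph V → Graph W → Set
_≅_ {V} {W} G H =
  Σ[ f ∈ V ↔ W ] (∀ u v → adj G u v ≡ adj H (Inverse.to f u) (Inverse.to f v))

-- G is isomorphic to a (not necessarily induced) subgraph of H.
_⊑_ : ∀ {V W} → Graph V → Graph W → Set
_⊑_ {V} {W} G H =
  Σ[ f ∈ (V → W) ] (Injective _≡_ _≡_ f × (∀ u v → Adj G u v → Adj H (f u) (f v)))

-- For injective f, this is the subgraph of G induced by the image of f.
pullback : ∀ {V W} → (W → V) → Graph V → Graph W
pullback f G = record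
  { adj        = λ u v → adj G (f u) (f v)
  ; adj-sym    = λ u v → adj-sym G (f u) (f v)
  ; adj-irrefl = λ v → adj-irrefl G (f v)
  }

-- Membership x ∈ S is proof-irrelevant, so the vertex type is in bijection with S.
induced : ∀ {n} → Graph (Fin n) → (S : Subset n) → Graph (Σ[ x ∈ Fin n ] x ∈ S)
induced G S = pullback proj₁ G

-- The remaining vertices are relabelled by Fin n in order.
_∖_ : ∀ {n} → Graph (Fin (suc n)) → Fin (suc n) → Graph (Fin n)
G ∖ v = pullback (punchIn v) G

N : ∀ {n} → Graph (Fin n) → Fin n → Subset n
N G v = tabulate (adj G v)

degree : ∀ {n} → Graph (Fin n) → Fin n → ℕ
degree G v = ∣ N G v ∣

Eulerian : ∀ {n} → Graph (Fin n) → Set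
Eulerian G = ∀ v → 2 ∣ degree G v

-- A connected graph is taken to have at least one vertex.
Connected : ∀ {V} → Graph V → Set
Connected {V} G = V × (∀ u v → Star (Adj G) u v)

data KTree (k : ℕ) : ∀ {n} → Graph (Fin n) → Set where
  complete : ∀ {n} {G : Graph (Fin n)} → G ≅ K k → KTree k G
  extend   : ∀ {n} {G : Graph (Fin (suc n))} (v : Fin (suc n)) →
             induced G (N G v) ≅ K k → KTree k (G ∖ v) → KTree k G

PartialKTree : ∀ {n} → ℕ → Graph (Fin n) → Set
PartialKTree k G = ∃[ m ] Σ[ H ∈ Graph (Fin m) ] (KTree k H × G ⊑ H)

-- The cycle start, rest₁, …, restₗ, start with l ≥ 2.  A cycle as a subgraph has
-- several such presentations; only its edges (InCycle) matter below.
record Cycle {V : Set} (G : Graph V) : Set where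
  field
    start    : V
    rest     : List V
    length≥3 : 3 ≤ length (start ∷ rest)
    distinct : Unique (start ∷ rest)
    closed   : Linked (Adj G) (start ∷ rest ∷ʳ start)

InCycle : ∀ {V} {G : Graph V} → V → V → Cycle G → Set
InCycle u v C = (u , v) List.∈ steps ⊎ (v , u) List.∈ steps
  where
  open Cycle C
  steps = zip (start ∷ rest) (rest ∷ʳ start)

EdgeDisjoint : ∀ {V} {G : Graph V} → Cycle G → Cycle G → Set
EdgeDisjoint C D = ∀ u v → InCycle u v C → ¬ InCycle u v D

-- Edge-disjoint cycles are distinct as subgraphs, since every cycle has an edge;
-- so the list has no repetitions and its length is the size of the set of cycles.
record CycleDecomposition {V : Set} (G : Graph V) : Set where
  field
    cycles   : List (Cycle G)
    disjoint : AllPairs EdgeDisjoint cycles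
    covers   : ∀ u v → Adj G u v → Any (InCycle u v) cycles

  size : ℕ
  size = length cycles

open CycleDecomposition public using (size)

-- IsCn G c states that cn(G) is defined and equal to c.
record IsCn {V : Set} (G : Graph V) (c : ℕ) : Set where
  field
    attained : Σ[ D ∈ CycleDecomposition G ] size D ≡ c
    minimal  : ∀ (D : CycleDecomposition G) → c ≤ size D

{-# OPTIONS --safe #-}
-- Every induced subgraph of a 3-tree with at least two vertices has two vertices of degree
-- at most 3, so an even subgraph G of a 3-tree has two vertices u, v of degree 0 or 2.
-- Induct on the size of a vertex set S supporting all edges, without assuming connectivity.
-- If u is isolated, delete it.  If some cycle passes through u and v, its removal isolates
-- both, so one cycle pays for two vertices.  Otherwise a Menger-type argument yields a cut
-- vertex w; by the handshake lemma both sides, which share only w, are even, and the bound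
-- 2 cn < |S| adds up over them.
module Submission where

open import Algebra.Properties.CommutativeSemigroup using (interchange)
open import Data.Bool using (Bool; true; false; not; T; _∧_; _∨_; _xor_; if_then_else_)
open import Data.Bool.Properties using (T-∧; T-∨; T?; T-irrelevant; xor-same; xor-comm; xor-assoc; xor-identityʳ; ∧-comm; ∨-comm)
open import Data.Fin using (Fin; zero; suc; punchIn; punchOut; _≟_)
open import Data.Fin.Properties using (any?; all?; injective⇒≤; suc-injective; punchIn-injective; punchInᵢ≢i; punchIn-punchOut; punchOut-injective)
import Data.Fin.Subset as Subset
open import Data.List using (List; []; _∷_; _++_; _∷ʳ_; zip; length; lookup; map; allFin; cartesianProduct; cartesianProductWith; concatMap)
import Data.List.Membership.DecPropositional as DecMembership
open import Data.List.Membership.Propositional using (_∈_; _∉_)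
open import Data.List.Membership.Propositional.Properties using (∈-++⁻; ∈-++⁺ˡ; ∈-++⁺ʳ; ∈-lookup; ∈-allFin; ∈-cartesianProduct⁺; ∈-cartesianProductWith⁺; ∈-concatMap⁺)
open import Data.List.Properties using (length-++; length-map)
open import Data.List.Relation.Unary.All as All using (All; []; _∷_)
import Data.List.Relation.Unary.All.Properties as Allₚ
open import Data.List.Relation.Unary.AllPairs as AllPairs using (AllPairs; []; _∷_)
import Data.List.Relation.Unary.AllPairs.Properties as AllPairsₚ
open import Data.List.Relation.Unary.Any as Any using (Any; here; there)
import Data.List.Relation.Unary.Any.Properties as Anyₚ
open import Data.List.Relation.Unary.Linked as Linked using (Linked; [-]; _∷_)
open import Data.List.Relation.Unary.Unique.DecPropositional using (unique?)
open import Data.List.Relation.Unary.Unique.Propositional using (Unique)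
open import Data.Nat using (ℕ; zero; suc; _+_; _≤_; _<_; _∸_; ⌊_/2⌋; z≤n; s≤s; _≤?_)
open import Data.Nat.Divisibility using (_∣_; divides)
open import Data.Nat.Induction using (<-wellFounded)
open import Data.Nat.Properties hiding (_≟_; suc-injective)
open import Data.Product using (Σ-syntax; ∃-syntax; _×_; _,_; proj₁; proj₂)
open import Data.Product.Properties using (≡-dec)
open import Data.Sum using (_⊎_; inj₁; inj₂; [_,_]′)
open import Data.Vec using (tabulate)
open import Data.Vec.Properties using (lookup⇒[]=; lookup∘tabulate)
open import Function using (_↔_; _∘_; id; Inverse; Injective; Equivalence)
open import Induction.WellFounded using (Acc; acc)
open import Relation.Binary.PropositionalEquality
open import Relation.Nullary using (¬_; Dec; yes; no; does; contradiction)
open import Relation.Nullary.Decidable using (¬?; _×-dec_; _⊎-dec_; _→-dec_; map′; decidable-stable; dec-true; dec-false)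
open import Defs

-- Counting and parity

-- The bound 3 works through parity: an even vertex of degree at most 3 loses all its edges with any
-- single cycle through it, which fails for degree 4.
--
-- The strict form of the bound makes cutting free. Two parts that share one vertex have sizes
-- adding up to at most `|S| + 1`; the two strict inequalities gain two units, one to pay for the
-- shared vertex and one to keep the sum strict.
--
-- Removing a cycle may disconnect the graph, so connectivity could not be carried through the
-- induction. Disconnectedness is no extra case either: a separation at `w` asks for an edge from
-- `w` into one side, and nothing has to join `w` to the other.
--
-- The vertex type stays `Fin n` throughout. Only edges are removed, and `S` records the shrinking
-- vertex set, so a cycle of a part is a cycle of the whole with the same vertex list.
--
-- Since `cn` is a minimum, one decomposition within the bound does not yet produce its value; a
-- finite search does.

∧⁺ : ∀ {a b} → T a → T b → T (a ∧ b)
∧⁺ p q = Equivalence.from T-∧ (p , q)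

∧⁻ˡ : ∀ a {b} → T (a ∧ b) → T a
∧⁻ˡ a p = proj₁ (Equivalence.to (T-∧ {a}) p)

∧⁻ʳ : ∀ a {b} → T (a ∧ b) → T b
∧⁻ʳ a p = proj₂ (Equivalence.to (T-∧ {a}) p)

not⁺ : ∀ {a} → ¬ T a → T (not a)
not⁺ {true}  p = contradiction _ p
not⁺ {false} _ = _

not⁻ : ∀ a → T (not a) → ¬ T a
not⁻ false _ ()

T⇒≡ : ∀ {a} → T a → a ≡ true
T⇒≡ {true} _ = refl

¬T⇒≡ : ∀ {a} → ¬ T a → a ≡ false
¬T⇒≡ {true}  p = contradiction _ p
¬T⇒≡ {false} _ = refl

does⁺ : ∀ {A : Set} (d : Dec A) → A → T (does d)
does⁺ d a = subst T (sym (dec-true d a)) _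

does⁻ : ∀ {A : Set} (d : Dec A) → T (does d) → A
does⁻ (yes a) _ = a

bit : Bool → ℕ
bit b = if b then 1 else 0

count : ∀ {n} → (Fin n → Bool) → ℕ
count {zero}  f = 0
count {suc n} f = bit (f zero) + count (f ∘ suc)

count-mono : ∀ {n} (f g : Fin n → Bool) → (∀ x → T (f x) → T (g x)) → count f ≤ count g
count-mono {zero}  f g f⊆g = z≤n
count-mono {suc n} f g f⊆g =
  +-mono-≤ (bit-mono (f⊆g zero)) (count-mono (f ∘ suc) (g ∘ suc) (f⊆g ∘ suc))
  where
  bit-mono : ∀ {a b} → (T a → T b) → bit a ≤ bit b
  bit-mono {false}         _ = z≤n
  bit-mono {true}  {true}  _ = ≤-refl
  bit-mono {true}  {false} p = contradiction (p _) λ ()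

count-cong : ∀ {n} {f g : Fin n → Bool} → (∀ x → f x ≡ g x) → count f ≡ count g
count-cong {zero}  f≗g = refl
count-cong {suc n} f≗g = cong₂ (λ b k → bit b + k) (f≗g zero) (count-cong (f≗g ∘ suc))

count-split : ∀ {n} (f g : Fin n → Bool) →
  count f ≡ count (λ x → f x ∧ g x) + count (λ x → f x ∧ not (g x))
count-split {zero}  f g = refl
count-split {suc n} f g with f zero | g zero | count-split (f ∘ suc) (g ∘ suc)
... | false | _     | eq = eq
... | true  | true  | eq = cong suc eq
... | true  | false | eq = trans (cong suc eq) (sym (+-suc _ _))

count-all : ∀ n → count {n} (λ _ → true) ≡ n
count-all zero    = refl
count-all (suc n) = cong suc (count-all n)

count≤n : ∀ {n} (f : Fin n → Bool) → count f ≤ n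
count≤n {n} f = subst (count f ≤_) (count-all n) (count-mono f (λ _ → true) _)

count-none : ∀ n → count {n} (λ _ → false) ≡ 0
count-none zero    = refl
count-none (suc n) = count-none n

count-single : ∀ {n} (y : Fin n) → count (λ x → does (x ≟ y)) ≡ 1
count-single {suc n} zero = cong suc (count-none n)
count-single (suc y)      = count-single y

infixl 6 _−_

_−_ : ∀ {n} → (Fin n → Bool) → Fin n → Fin n → Bool
(S − u) x = S x ∧ not (does (x ≟ u))

−⁺ : ∀ {n} (S : Fin n → Bool) {u x} → T (S x) → x ≢ u → T ((S − u) x)
−⁺ S {u} {x} Sx x≢u = ∧⁺ Sx (not⁺ (x≢u ∘ does⁻ (x ≟ u)))

count-− : ∀ {n} (S : Fin n → Bool) {u} → T (S u) → count S ≡ suc (count (S − u))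
count-− S {u} Su =
  trans (count-split S λ x → does (x ≟ u))
        (cong (_+ count (S − u)) (trans (count-cong pointwise) (count-single u)))
  where
  pointwise : ∀ x → S x ∧ does (x ≟ u) ≡ does (x ≟ u)
  pointwise x with x ≟ u
  ... | yes refl rewrite T⇒≡ Su = refl
  ... | no  _ = ∧-comm (S x) false

count-pos : ∀ {n} (S : Fin n → Bool) {u} → T (S u) → 1 ≤ count S
count-pos S Su = subst (1 ≤_) (sym (count-− S Su)) (s≤s z≤n)

count-two : ∀ {n} (S : Fin n → Bool) {u v} → T (S u) → T (S v) → v ≢ u → 2 ≤ count S
count-two S Su Sv v≢u =
  subst (2 ≤_) (sym (count-− S Su)) (s≤s (count-pos (S − _) (−⁺ S Sv v≢u)))

count-punchIn : ∀ {n} (i : Fin (suc n)) (f : Fin (suc n) → Bool) →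
  count f ≡ bit (f i) + count (f ∘ punchIn i)
count-punchIn zero f = refl
count-punchIn {suc n} (suc i) f = begin
  bit (f zero) + count (f ∘ suc)
    ≡⟨ cong (bit (f zero) +_) (count-punchIn i (f ∘ suc)) ⟩
  bit (f zero) + (bit (f (suc i)) + rest)
    ≡⟨ +-assoc (bit (f zero)) (bit (f (suc i))) rest ⟨
  bit (f zero) + bit (f (suc i)) + rest
    ≡⟨ cong (_+ rest) (+-comm (bit (f zero)) (bit (f (suc i)))) ⟩
  bit (f (suc i)) + bit (f zero) + rest
    ≡⟨ +-assoc (bit (f (suc i))) (bit (f zero)) rest ⟩
  bit (f (suc i)) + (bit (f zero) + rest) ∎
  where
  open ≡-Reasoning
  rest = count (f ∘ suc ∘ punchIn i)

count-missing : ∀ {n} (i : Fin n) (f : Fin n → Bool) → f i ≡ false → suc (count f) ≤ n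
count-missing {suc n} i f fi≡false = s≤s (begin
  count f                              ≡⟨ count-punchIn i f ⟩
  bit (f i) + count (f ∘ punchIn i)    ≡⟨ cong (λ b → bit b + count (f ∘ punchIn i)) fi≡false ⟩
  count (f ∘ punchIn i)                ≤⟨ count≤n (f ∘ punchIn i) ⟩
  n                                    ∎)
  where open ≤-Reasoning

-- Turns a Boolean subset into an injection from `Fin k`, the form in which induced subgraphs of a
-- 3-tree are treated. `count-at` carries degrees inside the subset from one form to the other.
record Enumeration {n} (S : Fin n → Bool) (k : ℕ) : Set where
  field
    at        : Fin k → Fin n
    injective : Injective _≡_ _≡_ at
    member    : ∀ i → T (S (at i))
    count-at  : ∀ P → count (P ∘ at) ≡ count (λ x → P x ∧ S x)

enumerate : ∀ {n} (S : Fin n → Bool) → Enumeration S (count S)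
enumerate {zero} S = record
  { at = λ () ; injective = λ { {()} } ; member = λ () ; count-at = λ _ → refl }
enumerate {suc n} S with S zero in eq | enumerate (S ∘ suc)
... | false | e = record
  { at        = suc ∘ at
  ; injective = injective ∘ suc-injective
  ; member    = member
  ; count-at  = λ P → trans (count-at (P ∘ suc))
      (cong (λ b → bit b + count (λ x → P (suc x) ∧ S (suc x)))
            (sym (trans (cong (P zero ∧_) eq) (∧-comm (P zero) false))))
  }
  where open Enumeration e
... | true | e = record
  { at        = at′
  ; injective = injective′
  ; member    = member′
  ; count-at  = λ P → cong₂ (λ b k → bit b + k)
      (sym (trans (cong (P zero ∧_) eq) (∧-comm (P zero) true)))
      (count-at (P ∘ suc))
  }
  where
  open Enumeration e
  at′ : Fin (suc (count (S ∘ suc))) → Fin (suc n)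
  at′ zero    = zero
  at′ (suc i) = suc (at i)

  injective′ : Injective _≡_ _≡_ at′
  injective′ {zero}  {zero}  _ = refl
  injective′ {suc i} {suc j} p = cong suc (injective (suc-injective p))

  member′ : ∀ i → T (S (at′ i))
  member′ zero    = subst T (sym eq) _
  member′ (suc i) = member i

-- `h` takes the membership proof because the isomorphism used in `few-neighbours` is defined on
-- neighbours only.
count-injection : ∀ {n k} (S : Fin n → Bool) (h : ∀ x → T (S x) → Fin k) →
  (∀ x y p q → h x p ≡ h y q → x ≡ y) → count S ≤ k
count-injection S h h-injective =
  injective⇒≤ {f = λ i → h (at i) (member i)} (injective ∘ h-injective _ _ _ _)
  where open Enumeration (enumerate S)

parity : ∀ {n} → (Fin n → Bool) → Bool
parity {zero}  f = false
parity {suc n} f = f zero xor parity (f ∘ suc)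

parity-cong : ∀ {n} {f g : Fin n → Bool} → (∀ x → f x ≡ g x) → parity f ≡ parity g
parity-cong {zero}  f≗g = refl
parity-cong {suc n} f≗g = cong₂ _xor_ (f≗g zero) (parity-cong (f≗g ∘ suc))

xor-interchange : ∀ a b c d → (a xor b) xor (c xor d) ≡ (a xor c) xor (b xor d)
xor-interchange a b c d = begin
  (a xor b) xor (c xor d) ≡⟨ xor-assoc a b (c xor d) ⟩
  a xor (b xor (c xor d)) ≡⟨ cong (a xor_) (xor-assoc b c d) ⟨
  a xor ((b xor c) xor d) ≡⟨ cong (λ e → a xor (e xor d)) (xor-comm b c) ⟩
  a xor ((c xor b) xor d) ≡⟨ cong (a xor_) (xor-assoc c b d) ⟩
  a xor (c xor (b xor d)) ≡⟨ xor-assoc a c (b xor d) ⟨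
  (a xor c) xor (b xor d) ∎
  where open ≡-Reasoning

parity-xor : ∀ {n} (f g : Fin n → Bool) →
  parity (λ x → f x xor g x) ≡ parity f xor parity g
parity-xor {zero}  f g = refl
parity-xor {suc n} f g =
  trans (cong ((f zero xor g zero) xor_) (parity-xor (f ∘ suc) (g ∘ suc)))
        (xor-interchange (f zero) (g zero) _ _)

parity-none : ∀ {n} (f : Fin n → Bool) → (∀ x → f x ≡ false) → parity f ≡ false
parity-none {zero}  f f≗false = refl
parity-none {suc n} f f≗false =
  cong₂ _xor_ (f≗false zero) (parity-none (f ∘ suc) (f≗false ∘ suc))

parity-only : ∀ {n} (f : Fin n → Bool) w → (∀ x → x ≢ w → f x ≡ false) → parity f ≡ f w
parity-only {suc n} f zero    f≗false =
  trans (cong (f zero xor_) (parity-none (f ∘ suc) λ x → f≗false (suc x) λ ()))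
        (xor-identityʳ (f zero))
parity-only {suc n} f (suc w) f≗false =
  cong₂ _xor_ (f≗false zero λ ())
              (parity-only (f ∘ suc) w λ x x≢w → f≗false (suc x) (x≢w ∘ suc-injective))

parity-split : ∀ {n} (f g : Fin n → Bool) →
  parity f ≡ parity (λ x → f x ∧ g x) xor parity (λ x → f x ∧ not (g x))
parity-split f g = trans (parity-cong λ x → split (f x) (g x))
                         (parity-xor (λ x → f x ∧ g x) (λ x → f x ∧ not (g x)))
  where
  split : ∀ a b → a ≡ (a ∧ b) xor (a ∧ not b)
  split false _     = refl
  split true  true  = refl
  split true  false = refl

parity-another : ∀ {n} (f : Fin n → Bool) → parity f ≡ false → ∀ {y} → T (f y) →
  ∃[ z ] z ≢ y × T (f z)
parity-another f even {y} fy with any? (λ z → ¬? (z ≟ y) ×-dec T? (f z))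
... | yes found = found
... | no  none  = contradiction
  (trans (sym even)
    (trans (parity-only f y λ x x≢y → ¬T⇒≡ λ fx → none (x , x≢y , fx)) (T⇒≡ fy)))
  λ ()

parity-small : ∀ {n} (f : Fin n → Bool) → parity f ≡ false → count f ≤ 1 → ∀ y → ¬ T (f y)
parity-small f even small y fy with z , z≢y , fz ← parity-another f even fy =
  contradiction (count-two f fy fz z≢y) (<⇒≱ (s≤s small))

-- The first row and the first column are equal by symmetry and cancel modulo 2, which leaves the
-- matrix without vertex `zero`.
handshake : ∀ {n} (M : Fin n → Fin n → Bool) →
  (∀ x y → M x y ≡ M y x) → (∀ x → M x x ≡ false) → parity (λ x → parity (M x)) ≡ false
handshake {zero}  M M-sym M-irrefl = refl
handshake {suc n} M M-sym M-irrefl = begin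
  (M zero zero xor parity (M zero ∘ suc)) xor parity (λ x → parity (M (suc x)))
    ≡⟨ cong₂ (λ a b → (a xor parity (M zero ∘ suc)) xor b) (M-irrefl zero)
             (parity-xor (λ x → M (suc x) zero) λ x → parity (M (suc x) ∘ suc)) ⟩
  parity (M zero ∘ suc) xor (parity (λ x → M (suc x) zero) xor inner)
    ≡⟨ cong₂ (λ a b → parity (M zero ∘ suc) xor (a xor b))
             (parity-cong λ x → M-sym (suc x) zero)
             (handshake (λ x y → M (suc x) (suc y))
                        (λ x y → M-sym (suc x) (suc y)) (M-irrefl ∘ suc)) ⟩
  parity (M zero ∘ suc) xor (parity (M zero ∘ suc) xor false)
    ≡⟨ cong (parity (M zero ∘ suc) xor_) (xor-identityʳ _) ⟩
  parity (M zero ∘ suc) xor parity (M zero ∘ suc)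
    ≡⟨ xor-same (parity (M zero ∘ suc)) ⟩
  false ∎
  where
  open ≡-Reasoning
  inner = parity (λ x → parity (M (suc x) ∘ suc))

odd : ℕ → Bool
odd zero    = false
odd (suc k) = not (odd k)

odd-even : ∀ {k} → 2 ∣ k → odd k ≡ false
odd-even (divides zero    refl) = refl
odd-even (divides (suc q) refl) rewrite odd-even (divides q refl) = refl

odd-count : ∀ {n} (f : Fin n → Bool) → odd (count f) ≡ parity f
odd-count {zero}  f = refl
odd-count {suc n} f with f zero
... | true  = cong not (odd-count (f ∘ suc))
... | false = odd-count (f ∘ suc)

∣tabulate∣ : ∀ {n} (f : Fin n → Bool) → Subset.∣ tabulate f ∣ ≡ count f
∣tabulate∣ {zero}  f = refl
∣tabulate∣ {suc n} f with f zero
... | true  = cong suc (∣tabulate∣ (f ∘ suc))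
... | false = ∣tabulate∣ (f ∘ suc)

-- Vertices of low degree in partial 3-trees

Even : ∀ {n} → Graph (Fin n) → Set
Even G = ∀ v → parity (adj G v) ≡ false

Eulerian⇒Even : ∀ {n} (G : Graph (Fin n)) → Eulerian G → Even G
Eulerian⇒Even G eulerian v =
  trans (sym (odd-count (adj G v)))
        (trans (cong odd (sym (∣tabulate∣ (adj G v)))) (odd-even (eulerian v)))

LowPair : ∀ {n s} → Graph (Fin n) → (Fin s → Fin n) → Set
LowPair G f = ∃[ i ] ∃[ j ] i ≢ j × ¬ Adj G (f i) (f j) ×
  count (λ x → adj G (f i) (f x)) ≤ 3 × count (λ x → adj G (f j) (f x)) ≤ 3

↔-injective : ∀ {V W : Set} (f : V ↔ W) → Injective _≡_ _≡_ (Inverse.to f)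
↔-injective f {x} {y} eq =
  trans (sym (Inverse.strictlyInverseʳ f x))
        (trans (cong (Inverse.from f) eq) (Inverse.strictlyInverseʳ f y))

K-complete : ∀ {k} {x y : Fin k} → x ≢ y → Adj (K k) x y
K-complete {x = x} {y} x≢y with x ≟ y
... | yes x≡y = contradiction x≡y x≢y
... | no  _   = _

∈N⁺ : ∀ {n} (H : Graph (Fin n)) {w x} → Adj H w x → x Subset.∈ N H w
∈N⁺ H {w} {x} wx = lookup⇒[]= x _ (trans (lookup∘tabulate (adj H w) x) (T⇒≡ wx))

restrictTo : ∀ {n s} (w : Fin (suc n)) (f : Fin s → Fin (suc n)) → Injective _≡_ _≡_ f →
  (∀ i → w ≢ f i) → Σ[ g ∈ (Fin s → Fin n) ] Injective _≡_ _≡_ g × (∀ i → punchIn w (g i) ≡ f i)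
restrictTo w f f-injective w≢f =
  (λ i → punchOut (w≢f i)) ,
  (λ {i} {j} → f-injective ∘ punchOut-injective (w≢f i) (w≢f j)) ,
  (λ i → punchIn-punchOut (w≢f i))

neighbours-clique : ∀ {n} (H : Graph (Fin n)) w → induced H (N H w) ≅ K 3 →
  ∀ {x y} → Adj H w x → Adj H w y → x ≢ y → Adj H x y
neighbours-clique H w (iso , iso-adj) {x} {y} wx wy x≢y =
  subst T (sym (iso-adj (x , ∈N⁺ H wx) (y , ∈N⁺ H wy)))
    (K-complete λ eq → x≢y (cong proj₁ (↔-injective iso eq)))

few-neighbours : ∀ {n s} (H : Graph (Fin n)) w → induced H (N H w) ≅ K 3 →
  (f : Fin s → Fin n) → Injective _≡_ _≡_ f → count (λ x → adj H w (f x)) ≤ 3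
few-neighbours H w (iso , _) f f-injective =
  count-injection _ (λ x wx → Inverse.to iso (f x , ∈N⁺ H wx))
    (λ x y p q eq → f-injective (cong proj₁ (↔-injective iso eq)))

-- Non-adjacency of the pair carries the induction. The neighbours of the last vertex `w` form a
-- clique, so of two non-adjacent vertices one is not joined to `w` and keeps its degree when `w` is
-- put back; `w` itself becomes its partner. Five vertices are required because the complete graph
-- on four is a 3-tree without a non-adjacent pair.
kTree⇒lowPair : ∀ {n} {H : Graph (Fin n)} → KTree 3 H →
  ∀ {s} (f : Fin s → Fin n) → Injective _≡_ _≡_ f → 5 ≤ s → LowPair H f
kTree⇒lowPair (complete (iso , _)) f f-injective 5≤s =
  contradiction (≤-trans 5≤s (injective⇒≤ (f-injective ∘ ↔-injective iso))) (<⇒≱ (s≤s (s≤s (s≤s (s≤s z≤n)))))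
kTree⇒lowPair {H = H} (extend w iso tree) f f-injective 5≤s with any? (λ i → f i ≟ w)
... | no w∉f
  with g , g-injective , g≗f ← restrictTo w f f-injective (λ i w≡fi → w∉f (i , sym w≡fi))
  with i , j , i≢j , ij , low-i , low-j ← kTree⇒lowPair tree g g-injective 5≤s =
  i , j , i≢j , ij ∘ subst T (sym (adj≡ i j)) , low i low-i , low j low-j
  where
  adj≡ : ∀ i j → adj (H ∖ w) (g i) (g j) ≡ adj H (f i) (f j)
  adj≡ i j = cong₂ (adj H) (g≗f i) (g≗f j)

  low : ∀ i → count (λ x → adj (H ∖ w) (g i) (g x)) ≤ 3 → count (λ x → adj H (f i) (f x)) ≤ 3
  low i = subst (_≤ 3) (count-cong (adj≡ i))
kTree⇒lowPair {H = H} (extend w iso tree) {suc s} f f-injective (s≤s 4≤s) | yes (i₀ , refl) =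
  i₀ , punchIn i₀ k , punchInᵢ≢i i₀ k ∘ sym , ¬wk , few-neighbours H w iso f f-injective , low-k
  where
  f′ : Fin s → _
  f′ = f ∘ punchIn i₀

  f′-injective : Injective _≡_ _≡_ f′
  f′-injective = punchIn-injective i₀ _ _ ∘ f-injective

  w≢f′ : ∀ i → w ≢ f′ i
  w≢f′ i eq = punchInᵢ≢i i₀ i (sym (f-injective eq))

  few : count (adj H w ∘ f′) ≤ 3
  few = few-neighbours H w iso f′ f′-injective

  second : ∃[ k ] ¬ Adj H w (f′ k) × count (λ x → adj H (f′ k) (f′ x)) ≤ 3
  second with m≤n⇒m<n∨m≡n 4≤s
  -- Exactly four vertices besides `w`, too few for the induction hypothesis. At most three of them
  -- are joined to `w`, and the remaining one has only three possible neighbours among the four.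
  ... | inj₂ refl with any? (λ k → ¬? (T? (adj H w (f′ k))))
  ...   | yes (k , ¬wk) = k , ¬wk ,
    ≤-pred (count-missing k (λ x → adj H (f′ k) (f′ x)) (adj-irrefl H (f′ k)))
  ...   | no  all = contradiction
    (≤-trans (≤-reflexive (sym (count-all 4)))
      (count-mono (λ _ → true) (adj H w ∘ f′) λ x _ → decidable-stable (T? _) λ ¬wx → all (x , ¬wx)))
    (<⇒≱ (s≤s few))
  second | inj₁ 5≤s
    with g , g-injective , g≗f′ ← restrictTo w f′ f′-injective w≢f′
    with i , j , i≢j , ij , low-i , low-j ← kTree⇒lowPair tree g g-injective 5≤s
    with T? (adj H w (f′ i)) | T? (adj H w (f′ j))
  ... | no ¬wi | _ = i , ¬wi , subst (_≤ 3) (count-cong λ x → cong₂ (adj H) (g≗f′ i) (g≗f′ x)) low-i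
  ... | _ | no ¬wj = j , ¬wj , subst (_≤ 3) (count-cong λ x → cong₂ (adj H) (g≗f′ j) (g≗f′ x)) low-j
  ... | yes wi | yes wj = contradiction
    (subst T (sym (cong₂ (adj H) (g≗f′ i) (g≗f′ j)))
      (neighbours-clique H w iso wi wj (i≢j ∘ f′-injective)))
    ij

  k = proj₁ second
  ¬wk = proj₁ (proj₂ second)

  low-k : count (λ x → adj H (f′ k) (f x)) ≤ 3
  low-k = begin
    count (λ x → adj H (f′ k) (f x))
      ≡⟨ count-punchIn i₀ (λ x → adj H (f′ k) (f x)) ⟩
    bit (adj H (f′ k) w) + count (λ x → adj H (f′ k) (f′ x))
      ≡⟨ cong (λ b → bit b + count (λ x → adj H (f′ k) (f′ x))) (trans (adj-sym H (f′ k) w) (¬T⇒≡ ¬wk)) ⟩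
    count (λ x → adj H (f′ k) (f′ x))
      ≤⟨ proj₂ (proj₂ second) ⟩
    3 ∎
    where open ≤-Reasoning

-- All that the induction keeps of the 3-tree. Only upper bounds on degrees occur, so the property
-- passes to every subgraph on the same vertices.
Sparse : ∀ {n} → Graph (Fin n) → Set
Sparse G = ∀ S → 2 ≤ count S → ∃[ u ] ∃[ v ] u ≢ v × T (S u) × T (S v) ×
  count (λ x → adj G u x ∧ S x) ≤ 3 × count (λ x → adj G v x ∧ S x) ≤ 3

Sparse-⊆ : ∀ {n} (G G′ : Graph (Fin n)) → (∀ u v → Adj G′ u v → Adj G u v) → Sparse G → Sparse G′
Sparse-⊆ G G′ G′⊆G sparse S 2≤S
  with u , v , u≢v , Su , Sv , low-u , low-v ← sparse S 2≤S =
  u , v , u≢v , Su , Sv , mono u low-u , mono v low-v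
  where
  mono : ∀ u → count (λ x → adj G u x ∧ S x) ≤ 3 → count (λ x → adj G′ u x ∧ S x) ≤ 3
  mono u = ≤-trans (count-mono _ _ λ x p →
    ∧⁺ (G′⊆G u x (∧⁻ˡ (adj G′ u x) p)) (∧⁻ʳ (adj G′ u x) p))

-- Inside at most four vertices every degree is at most 3. From five on, the low pair comes from the
-- 3-tree `H`, and degrees in `G` are no larger.
partial3Tree⇒Sparse : ∀ {n} {G : Graph (Fin n)} → PartialKTree 3 G → Sparse G
partial3Tree⇒Sparse {G = G} (m , H , tree , e , e-injective , e-adj) S 2≤S =
  let i , j , i≢j , low-i , low-j = lowPair in
  at i , at j , i≢j ∘ injective , member i , member j ,
  subst (_≤ 3) (count-at (adj G (at i))) low-i , subst (_≤ 3) (count-at (adj G (at j))) low-j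
  where
  open Enumeration (enumerate S)

  low : Fin (count S) → Set
  low i = count (λ x → adj G (at i) (at x)) ≤ 3

  distinctPair : ∀ {s} → 2 ≤ s → Σ[ i ∈ Fin s ] Σ[ j ∈ Fin s ] i ≢ j
  distinctPair (s≤s (s≤s _)) = zero , suc zero , λ ()

  lowPair : ∃[ i ] ∃[ j ] i ≢ j × low i × low j
  lowPair with 5 ≤? count S
  ... | yes 5≤S with i , j , i≢j , _ , low-i , low-j ← kTree⇒lowPair tree (e ∘ at) (injective ∘ e-injective) 5≤S =
    i , j , i≢j , mono i low-i , mono j low-j
    where
    mono : ∀ i → count (λ x → adj H (e (at i)) (e (at x))) ≤ 3 → low i
    mono i = ≤-trans (count-mono _ _ λ x → e-adj (at i) (at x))
  ... | no  5≰S with i , j , i≢j ← distinctPair 2≤S = i , j , i≢j , few i , few j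
    where
    few : ∀ i → low i
    few i = ≤-pred (≤-trans (count-missing i (λ x → adj G (at i) (at x)) (adj-irrefl G (at i)))
                            (≤-pred (≰⇒> 5≰S)))

-- Paths and cycles

module _ {n} (G : Graph (Fin n)) where

  open import Data.List.Membership.DecPropositional (_≟_ {n}) using (_∈?_)

  Adj-sym : ∀ {a b} → Adj G a b → Adj G b a
  Adj-sym {a} {b} = subst T (adj-sym G a b)

  Adj⇒≢ : ∀ {a b} → Adj G a b → a ≢ b
  Adj⇒≢ {a} ab refl = subst T (adj-irrefl G a) ab

  -- The list omits the first vertex.
  data Path : Fin n → Fin n → List (Fin n) → Set where
    []   : ∀ {a} → Path a a []
    cons : ∀ {a b c xs} → Adj G a b → a ∉ b ∷ xs → Path b c xs → Path a c (b ∷ xs)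

  end∈ : ∀ {a b xs} → Path a b xs → b ∈ a ∷ xs
  end∈ []           = here refl
  end∈ (cons _ _ p) = there (end∈ p)

  suffix : ∀ {a b c xs} → Path a b xs → c ∈ a ∷ xs →
    ∃[ ys ] Path c b ys × (∀ {z} → z ∈ c ∷ ys → z ∈ a ∷ xs)
  suffix p            (here refl) = _ , p , id
  suffix (cons _ _ p) (there c∈) with ys , q , q⊆ ← suffix p c∈ = ys , q , there ∘ q⊆

  suffix⁺ : ∀ {a b c xs} → Path a b xs → c ∈ xs →
    ∃[ ys ] Path c b ys × (∀ {z} → z ∈ c ∷ ys → z ∈ xs)
  suffix⁺ (cons _ _ p) c∈ = suffix p c∈

  start∉ : ∀ {a b xs} → Path a b xs → a ∉ xs
  start∉ (cons _ a∉ _) = a∉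

  join : ∀ {a b c d xs ys} → Path a b xs → Adj G b c → Path c d ys →
    (∀ {z} → z ∈ a ∷ xs → z ∉ c ∷ ys) → Path a d (xs ++ c ∷ ys)
  join []                         bc q disj = cons bc (disj (here refl)) q
  join {xs = _ ∷ xs} (cons ab′ a∉ p) bc q disj =
    cons ab′ (λ a∈ → [ a∉ , disj (here refl) ]′ (∈-++⁻ (_ ∷ xs) a∈)) (join p bc q (disj ∘ there))

  reverse : ∀ {a b xs} → Path a b xs → ∃[ ys ] Path b a ys × (∀ {z} → z ∈ b ∷ ys → z ∈ a ∷ xs)
  reverse []             = [] , [] , id
  reverse {a} {c} (cons {xs = xs} ab a∉ p) with ys , q , q⊆ ← reverse p =
    ys ++ a ∷ [] ,
    join q (Adj-sym ab) [] (λ { z∈ (here refl) → a∉ (q⊆ z∈) }) ,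
    λ z∈ → [ there ∘ q⊆ , (λ { (here refl) → here refl }) ]′ (∈-++⁻ (c ∷ ys) z∈)

  path-unique : ∀ {a b xs} → Path a b xs → Unique (a ∷ xs)
  path-unique []            = [] ∷ []
  path-unique (cons _ a∉ p) = Allₚ.¬Any⇒All¬ _ a∉ ∷ path-unique p

  path-linked : ∀ {a b c xs} → Path a b xs → Adj G b c → Linked (Adj G) (a ∷ xs ∷ʳ c)
  path-linked []            bc = bc ∷ [-]
  path-linked (cons ab _ p) bc = ab ∷ path-linked p bc

  closePath : ∀ {a b xs} → Path a b xs → Adj G b a → 2 ≤ length xs → Cycle G
  closePath {a} {xs = xs} p ba 2≤xs = record
    { start    = a
    ; rest     = xs
    ; length≥3 = s≤s 2≤xs
    ; distinct = path-unique p
    ; closed   = path-linked p ba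
    }

  -- A cycle through u and x, as two internally disjoint paths, at least one of which
  -- is longer than an edge.
  record Through (u x : Fin n) : Set where
    field
      {long-list short-list} : List (Fin n)
      long    : Path x u long-list
      short   : Path x u short-list
      meet    : ∀ {z} → z ∈ x ∷ long-list → z ∈ x ∷ short-list → z ≡ x ⊎ z ≡ u
      inner   : Fin n
      inner∈  : inner ∈ long-list
      inner≢u : inner ≢ u
      x≢u     : x ≢ u

  -- Reverse the short path, drop its first vertex `u` so that `u` is not listed twice, and append
  -- the long path; the edge from `u` to `d` closes the cycle. `inner` guarantees that the long path
  -- contributes at least two further vertices.
  Through⇒Cycle : ∀ {u x} → Through u x → Σ[ C ∈ Cycle G ]
    let vertices = Cycle.start C ∷ Cycle.rest C in u ∈ vertices × x ∈ vertices
  Through⇒Cycle {u} {x} through with reverse (Through.short through) | Through.long through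
    | Through.inner∈ through | Through.meet through
  ... | _ , [] , _ | _ | _ | _ = contradiction refl (Through.x≢u through)
  ... | _ ∷ ys , cons {b = d} ud u∉ q , q⊆ | cons {b = b} {xs = xs} xb x∉ p | inner∈ | meet =
    closePath whole ud 2≤ ,
    there (∈-++⁺ʳ ys (end∈ p)) , ∈-++⁺ˡ {ys = b ∷ xs} (end∈ q)
    where
    disj : ∀ {z} → z ∈ d ∷ ys → z ∉ b ∷ xs
    disj z∈ys z∈xs with meet (there z∈xs) (q⊆ (there z∈ys))
    ... | inj₁ refl = x∉ z∈xs
    ... | inj₂ refl = u∉ z∈ys

    whole : Path d u (ys ++ b ∷ xs)
    whole = join q xb p disj

    2≤xs : ∀ {a xs} → Path a u xs → Through.inner through ∈ a ∷ xs → 1 ≤ length xs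
    2≤xs []           (here eq) = contradiction eq (Through.inner≢u through)
    2≤xs (cons _ _ _) _         = s≤s z≤n

    2≤ : 2 ≤ length (ys ++ b ∷ xs)
    2≤ = begin
      2                             ≤⟨ s≤s (2≤xs p inner∈) ⟩
      length (b ∷ xs)               ≤⟨ m≤n+m _ (length ys) ⟩
      length ys + length (b ∷ xs)   ≡⟨ length-++ ys ⟨
      length (ys ++ b ∷ xs)         ∎
      where open ≤-Reasoning

  -- Searching for a cycle through two vertices or a cut vertex

  record Closed (w y : Fin n) (P : Fin n → Set) : Set where
    field
      set     : Fin n → Bool
      base    : T (set y)
      sound   : ∀ x → T (set x) → P x
      closed  : ∀ x z → T (set x) → Adj G x z → T (set z) ⊎ z ≡ w

  -- Reachability from `y` in the graph without `w`. `P` may carry data and need not be decidable,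
  -- so the set is built as a Boolean function and `P` is only propagated along it. The fuel `k`
  -- bounds the number of vertices still outside, which drops with every vertex added.
  grow : ∀ {P : Fin n → Set} {E : Set} w y → P y →
    (∀ x z → P x → Adj G x z → z ≢ w → P z ⊎ E) → Closed w y P ⊎ E
  grow {P} {E} w y Py step = go n (λ x → does (x ≟ y)) (does⁺ (y ≟ y) refl)
      (λ x x≡y → subst P (sym (does⁻ (x ≟ y) x≡y)) Py)
      (count≤n (λ x → not (does (x ≟ y))))
    where
    go : ∀ k (C : Fin n → Bool) → T (C y) → (∀ x → T (C x) → P x) →
      count (not ∘ C) ≤ k → Closed w y P ⊎ E
    go k C Cy C⊆P bound
      with any? (λ x → any? λ z → T? (C x) ×-dec T? (adj G x z) ×-dec ¬? (z ≟ w) ×-dec ¬? (T? (C z)))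
    ... | no none = inj₁ record
      { set = C ; base = Cy ; sound = C⊆P
      ; closed = λ x z Cx xz → closed x z Cx xz (T? (C z)) (z ≟ w)
      }
      where
      closed : ∀ x z → T (C x) → Adj G x z → Dec (T (C z)) → Dec (z ≡ w) → T (C z) ⊎ z ≡ w
      closed x z Cx xz (yes Cz) _         = inj₁ Cz
      closed x z Cx xz _        (yes z≡w) = inj₂ z≡w
      closed x z Cx xz (no ¬Cz) (no z≢w)  = contradiction (x , z , Cx , xz , z≢w , ¬Cz) none
    ... | yes (x , z , Cx , xz , z≢w , ¬Cz) with step x z (C⊆P x Cx) xz z≢w | k
    ...   | inj₂ e  | _     = inj₂ e
    ...   | inj₁ _  | zero  = contradiction (≤-trans (count-pos (not ∘ C) (not⁺ ¬Cz)) bound) λ ()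
    ...   | inj₁ Pz | suc k = go k C′ (Equivalence.from T-∨ (inj₁ Cy)) C′⊆P
      (≤-pred (≤-trans (s≤s (count-mono (not ∘ C′) (not ∘ C − z) C′ᶜ⊆))
                       (subst (_≤ suc k) (count-− (not ∘ C) (not⁺ ¬Cz)) bound)))
      where
      C′ : Fin n → Bool
      C′ x = C x ∨ does (x ≟ z)

      C′⊆P : ∀ x → T (C′ x) → P x
      C′⊆P x p with Equivalence.to (T-∨ {C x}) p
      ... | inj₁ Cx  = C⊆P x Cx
      ... | inj₂ x≡z = subst P (sym (does⁻ (x ≟ z) x≡z)) Pz

      C′ᶜ⊆ : ∀ x → T (not (C′ x)) → T ((not ∘ C − z) x)
      C′ᶜ⊆ x ¬C′x = −⁺ (not ∘ C)
        (not⁺ λ Cx → not⁻ (C′ x) ¬C′x (Equivalence.from T-∨ (inj₁ Cx)))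
        λ x≡z → not⁻ (C′ x) ¬C′x
          (Equivalence.from (T-∨ {C x}) (inj₂ (does⁺ (x ≟ z) x≡z)))

  record Reaches (w y : Fin n) (ks : List (Fin n)) : Set where
    field
      {last target} : Fin n
      {list}  : List (Fin n)
      path    : Path y last list
      avoids  : ∀ {z} → z ∈ y ∷ list → z ∉ ks
      step    : Adj G last target
      target∈ : target ∈ ks
      target≢ : target ≢ w

  -- Every vertex found keeps a path to `y` that avoids `ks`; an edge into `ks` at a vertex other
  -- than `w` ends the search. If there is none, `w` separates `y` from the rest of `ks`. The
  -- callers include `w` in `ks`, which keeps `w` itself out of the closed set.
  explore : ∀ w y ks → y ∉ ks → Closed w y (_∉ ks) ⊎ Reaches w y ks
  explore w y ks y∉ with grow {P = P} w y ([] , [] , λ { (here refl) → y∉ }) step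
    where
    P : Fin n → Set
    P z = ∃[ xs ] Path z y xs × (∀ {k} → k ∈ z ∷ xs → k ∉ ks)

    step : ∀ x z → P x → Adj G x z → z ≢ w → P z ⊎ Reaches w y ks
    step x z (xs , p , avoid) xz z≢w with z ∈? ks | z ∈? x ∷ xs
    ... | yes z∈ks | _ with ys , q , q⊆ ← reverse p = inj₂ record
      { path = q ; avoids = avoid ∘ q⊆ ; step = xz ; target∈ = z∈ks ; target≢ = z≢w }
    ... | no _ | yes z∈xs with ys , q , q⊆ ← suffix p z∈xs = inj₁ (ys , q , avoid ∘ q⊆)
    ... | no z∉ks | no z∉xs = inj₁ (x ∷ xs , cons (Adj-sym xz) z∉xs p ,
      λ { (here refl) → z∉ks ; (there k∈) → avoid k∈ })
  ... | inj₂ r = inj₂ r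
  ... | inj₁ c = inj₁ record
    { set = set ; base = base ; closed = closed
    ; sound = λ x x∈ → proj₂ (proj₂ (sound x x∈)) (here refl) }
    where open Closed c

  -- `inside` and `outside` witness that each of the two parts misses a vertex of `S`, so both are
  -- smaller. That `inside` lies in `S` follows from `cut-edge`, as `S` supports all edges.
  record Separation (S : Fin n → Bool) : Set where
    field
      cut inside outside : Fin n
      set        : Fin n → Bool
      cut∉       : ¬ T (set cut)
      inside∈    : T (set inside)
      outside∉   : ¬ T (set outside)
      outside≢   : outside ≢ cut
      outside∈S  : T (S outside)
      cut-edge   : Adj G cut inside
      closed     : ∀ x z → T (set x) → Adj G x z → T (set z) ⊎ z ≡ cut

  Closed⇒Separation : ∀ {S w y P} v → T (S v) → Closed w y P → ¬ P w → ¬ P v → v ≢ w →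
    Adj G w y → Separation S
  Closed⇒Separation {w = w} {y} v Sv c ¬Pw ¬Pv v≢w wy = record
    { cut = w ; inside = y ; outside = v ; set = set
    ; cut∉ = ¬Pw ∘ sound w ; inside∈ = base ; outside∉ = ¬Pv ∘ sound v ; outside≢ = v≢w ; outside∈S = Sv
    ; cut-edge = wy ; closed = closed
    }
    where open Closed c

  attach : ∀ {u x y xs ys} → x ≢ u → y ≢ u → Adj G y x → Path x u xs → Path y u ys →
    (∀ {z} → z ∈ y ∷ ys → z ∈ x ∷ xs → z ≡ u) → Through u y
  attach {x = x} x≢u y≢u yx p q meet = record
    { long    = cons yx (y≢u ∘ meet (here refl)) p
    ; short   = q
    ; meet    = λ { (here refl) _ → inj₁ refl ; (there z∈) z∈′ → inj₂ (meet z∈′ z∈) }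
    ; inner   = x
    ; inner∈  = here refl
    ; inner≢u = x≢u
    ; x≢u     = y≢u
    }

  -- For a neighbour `y` of `x` already on the cycle: one new path is what remains of its own path
  -- from `y` on, the other steps to `x` and follows the opposite path.
  attachSuffix : ∀ {u x y xs ys} → x ≢ u → y ≢ u → Adj G y x →
    Path x u xs → Path x u ys → (∀ {z} → z ∈ x ∷ xs → z ∈ x ∷ ys → z ≡ x ⊎ z ≡ u) →
    y ∈ xs → Through u y
  attachSuffix x≢u y≢u yx p q meet y∈ with rs , r , r⊆ ← suffix⁺ p y∈ =
    attach x≢u y≢u yx q r λ z∈r z∈q →
      [ (λ { refl → contradiction (r⊆ z∈r) (start∉ p) }) , id ]′ (meet (there (r⊆ z∈r)) z∈q)

  -- For a neighbour `y` off the cycle: one new path leaves along the detour to `target` and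
  -- continues on `p`, the other steps to `x` and follows `q`. As `target` comes after `x` on `p`,
  -- the part of `p` that is used avoids `x` and meets `q` only in `u`.
  attachDetour : ∀ {u x y xs ys} ks → x ≢ u → y ≢ u → Adj G y x →
    Path x u xs → Path x u ys → (∀ {z} → z ∈ x ∷ xs → z ∈ x ∷ ys → z ≡ x ⊎ z ≡ u) →
    (∀ {z} → z ∈ x ∷ xs → z ∈ ks) → (∀ {z} → z ∈ x ∷ ys → z ∈ ks) →
    (r : Reaches x y ks) → Reaches.target r ∈ xs → Through u y
  attachDetour {u} {x} {y} {xs} {ys} ks x≢u y≢u yx p q meet p⊆ q⊆ r target∈xs
    with ss , s , s⊆ ← suffix⁺ p target∈xs =
    attach x≢u y≢u yx q (join path step s λ z∈ → avoids z∈ ∘ p⊆ ∘ there ∘ s⊆)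
      λ z∈r z∈q → [ (λ z∈ → contradiction (q⊆ z∈q) (avoids z∈)) , onSuffix s⊆ z∈q ]′
        (∈-++⁻ (y ∷ list) z∈r)
    where
    open Reaches r
    onSuffix : ∀ {ss z} → (∀ {z} → z ∈ ss → z ∈ xs) → z ∈ x ∷ ys → z ∈ ss → z ≡ u
    onSuffix s⊆ z∈q z∈s with meet (there (s⊆ z∈s)) z∈q
    ... | inj₁ refl = contradiction (s⊆ z∈s) (start∉ p)
    ... | inj₂ z≡u  = z≡u

  -- If `y` can return to the cycle without passing `x`, the cycle is rerouted through `y`;
  -- otherwise `x` separates `y` from `u`.
  extendThrough : ∀ {S u} → T (S u) → ∀ x y → Through u x → Adj G x y → y ≢ u →
    Through u y ⊎ Separation S
  extendThrough {S} {u} Su x y through xy y≢u = result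
    where
    open Through through

    meet′ : ∀ {z} → z ∈ x ∷ short-list → z ∈ x ∷ long-list → z ≡ x ⊎ z ≡ u
    meet′ z∈ z∈′ = meet z∈′ z∈

    ks = x ∷ long-list ++ x ∷ short-list

    long⊆ : ∀ {z} → z ∈ x ∷ long-list → z ∈ ks
    long⊆ = ∈-++⁺ˡ

    short⊆ : ∀ {z} → z ∈ x ∷ short-list → z ∈ ks
    short⊆ = ∈-++⁺ʳ (x ∷ long-list)

    split : ∀ {z} → z ∈ ks → z ≢ x → z ∈ long-list ⊎ z ∈ short-list
    split z∈ z≢x with ∈-++⁻ (x ∷ long-list) z∈
    ... | inj₁ (here z≡x) = contradiction z≡x z≢x
    ... | inj₁ (there z∈) = inj₁ z∈
    ... | inj₂ (here z≡x) = contradiction z≡x z≢x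
    ... | inj₂ (there z∈) = inj₂ z∈

    yx = Adj-sym xy

    result : Through u y ⊎ Separation S
    result with y ∈? ks
    ... | yes y∈ = inj₁ ([ attachSuffix x≢u y≢u yx long short meet
                         , attachSuffix x≢u y≢u yx short long meet′ ]′ (split y∈ (Adj⇒≢ yx)))
    ... | no y∉ with explore x y ks y∉
    ...   | inj₁ c = inj₂ (Closed⇒Separation u Su c (contradiction (long⊆ (here refl)))
                            (contradiction (long⊆ (end∈ long))) (x≢u ∘ sym) xy)
    ...   | inj₂ r = inj₁ ([ attachDetour ks x≢u y≢u yx long short meet long⊆ short⊆ r
                           , attachDetour ks x≢u y≢u yx short long meet′ short⊆ long⊆ r ]′
                           (split (Reaches.target∈ r) (Reaches.target≢ r)))

  -- A path from `y` to `z` that avoids `u` closes up at `u`; if there is none, `u` is a cut vertex.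
  -- Listing `u` among the forbidden vertices keeps the path off `u`, and `target≢` then leaves `z`
  -- as the only possible target.
  throughNeighbour : ∀ {S} u y z → T (S z) → Adj G u y → Adj G u z → z ≢ y →
    Through u y ⊎ Separation S
  throughNeighbour u y z Sz uy uz z≢y with explore u y (u ∷ z ∷ []) (λ where
    (here y≡u)          → Adj⇒≢ uy (sym y≡u)
    (there (here y≡z))  → z≢y (sym y≡z))
  ... | inj₁ c = inj₂ (Closed⇒Separation z Sz c (contradiction (here refl))
                         (contradiction (there (here refl))) (Adj⇒≢ uz ∘ sym) uy)
  ... | inj₂ record { target∈ = here t≡u ; target≢ = t≢u } = contradiction t≡u t≢u
  ... | inj₂ record { list = list ; path = p ; avoids = avoids ; step = step ; target∈ = there (here refl) } =
    inj₁ record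
    { long    = join p step (cons (Adj-sym uz) (λ { (here z≡u) → Adj⇒≢ uz (sym z≡u) ; (there ()) }) []) λ where
        k∈ (here refl)         → avoids k∈ (there (here refl))
        k∈ (there (here refl)) → avoids k∈ (here refl)
    ; short   = cons (Adj-sym uy) (λ { (here y≡u) → Adj⇒≢ uy (sym y≡u) ; (there ()) }) []
    ; meet    = λ where
        _ (here refl)         → inj₁ refl
        _ (there (here refl)) → inj₂ refl
    ; inner   = z
    ; inner∈  = ∈-++⁺ʳ list (here refl)
    ; inner≢u = Adj⇒≢ uz ∘ sym
    ; x≢u     = Adj⇒≢ uy ∘ sym
    }

  -- Sharing a cycle with `u` spreads from `y` along the edges of the graph without `u`, unless a
  -- separation turns up on the way. If the spreading stops short of `v`, then `u` separates `y`
  -- from `v`; this includes the case that `v` is isolated or in another component.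
  through⊎separation : ∀ {S} u v → T (S u) → T (S v) → u ≢ v →
    ∀ {y z} → T (S z) → Adj G u y → Adj G u z → z ≢ y → Through u v ⊎ Separation S
  through⊎separation u v Su Sv u≢v {y} {z} Sz uy uz z≢y with throughNeighbour u y z Sz uy uz z≢y
  ... | inj₂ s = inj₂ s
  ... | inj₁ t with grow {P = Through u} u y t (extendThrough Su)
  ...   | inj₂ s = inj₂ s
  ...   | inj₁ c with T? (Closed.set c v)
  ...     | yes v∈ = inj₁ (Closed.sound c v v∈)
  ...     | no  v∉ = inj₂ record
    { cut = u ; inside = y ; outside = v ; set = set
    ; cut∉ = λ u∈ → Through.x≢u (sound u u∈) refl
    ; inside∈ = base ; outside∉ = v∉ ; outside≢ = u≢v ∘ sym ; outside∈S = Sv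
    ; cut-edge = uy ; closed = closed
    }
    where open Closed c

-- Cycles as lists of steps

module _ {n} {R : Fin n → Fin n → Set} where

  linked⇒steps : ∀ a xs z → Linked R (a ∷ xs ∷ʳ z) → All (λ (c , d) → R c d) (zip (a ∷ xs) (xs ∷ʳ z))
  linked⇒steps a []       z (az ∷ [-]) = az ∷ []
  linked⇒steps a (b ∷ xs) z (ab ∷ l)   = ab ∷ linked⇒steps b xs z l

  steps⇒linked : ∀ a xs z → All (λ (c , d) → R c d) (zip (a ∷ xs) (xs ∷ʳ z)) → Linked R (a ∷ xs ∷ʳ z)
  steps⇒linked a []       z (az ∷ []) = az ∷ [-]
  steps⇒linked a (b ∷ xs) z (ab ∷ l)  = ab ∷ steps⇒linked b xs z l

steps : ∀ {V} {G : Graph V} → Cycle G → List (V × V)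
steps C = zip (start ∷ rest) (rest ∷ʳ start)
  where open Cycle C

InCycle⇒Adj : ∀ {n} {G : Graph (Fin n)} (C : Cycle G) {u v} → InCycle u v C → Adj G u v
InCycle⇒Adj {G = G} C = [ All.lookup adjacent , Adj-sym G ∘ All.lookup adjacent ]′
  where
  open Cycle C
  adjacent = linked⇒steps start rest start closed

mapCycle : ∀ {V} {G G′ : Graph V} → (∀ u v → Adj G u v → Adj G′ u v) → Cycle G → Cycle G′
mapCycle G⊆G′ C = record
  { start = start ; rest = rest ; length≥3 = length≥3 ; distinct = distinct
  ; closed = Linked.map (G⊆G′ _ _) closed }
  where open Cycle C

vertex-step : ∀ {V : Set} (a : V) xs z {v} → v ∈ a ∷ xs → ∃[ w ] (v , w) ∈ zip (a ∷ xs) (xs ∷ʳ z)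
vertex-step a []       z (here refl) = z , here refl
vertex-step a (b ∷ xs) z (here refl) = b , here refl
vertex-step a (b ∷ xs) z (there v∈)  with w , vw∈ ← vertex-step b xs z v∈ = w , there vw∈

step-ends : ∀ {V : Set} (a : V) xs z {c d} → (c , d) ∈ zip (a ∷ xs) (xs ∷ʳ z) →
  c ∈ a ∷ xs × d ∈ xs ∷ʳ z
step-ends a []       z (here refl) = here refl , here refl
step-ends a (b ∷ xs) z (here refl) = here refl , here refl
step-ends a (b ∷ xs) z (there cd∈) with c∈ , d∈ ← step-ends b xs z cd∈ = there c∈ , there d∈

-- Difference as undirected edges, which prevents steps from cancelling in a sum modulo 2.
_#_ : ∀ {V : Set} → V × V → V × V → Set
(a , b) # (c , d) = ¬ (a ≡ c × b ≡ d) × ¬ (a ≡ d × b ≡ c)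

path-steps-# : ∀ {V : Set} (a : V) xs z → Unique (a ∷ xs) → z ∉ a ∷ xs →
  AllPairs _#_ (zip (a ∷ xs) (xs ∷ʳ z))
path-steps-# a []       z _            _  = [] ∷ []
path-steps-# a (b ∷ xs) z (a∉ ∷ unique) z∉ =
  All.tabulate (λ cd∈ → first (step-ends b xs z cd∈)) ∷ path-steps-# b xs z unique (z∉ ∘ there)
  where
  first : ∀ {c d} → c ∈ b ∷ xs × d ∈ xs ∷ʳ z → (a , b) # (c , d)
  first (c∈ , d∈) = (λ { (refl , _) → Allₚ.All¬⇒¬Any a∉ c∈ }) , λ { (refl , _) →
    [ Allₚ.All¬⇒¬Any a∉ ∘ there , (λ { (here refl) → z∉ (here refl) }) ]′ (∈-++⁻ xs d∈) }

-- Without its first step the cycle is a path from `b` to `a`, so only that step needs care. It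
-- could recur only backwards, as `(b , a)`, in a closed walk on two vertices; the length bound
-- excludes this.
cycle-steps-# : ∀ {V : Set} (a : V) xs → Unique (a ∷ xs) → 2 ≤ length xs →
  AllPairs _#_ (zip (a ∷ xs) (xs ∷ʳ a))
cycle-steps-# a (b ∷ [])     _                         (s≤s ())
cycle-steps-# a (b ∷ e ∷ xs) (a∉ ∷ unique@(b∉ ∷ _)) _ =
  All.tabulate first ∷ path-steps-# b (e ∷ xs) a unique (Allₚ.All¬⇒¬Any a∉)
  where
  first : ∀ {cd} → cd ∈ zip (b ∷ e ∷ xs) (e ∷ xs ∷ʳ a) → (a , b) # cd
  first cd∈ = (λ { (refl , _) → Allₚ.All¬⇒¬Any a∉ (proj₁ (step-ends b (e ∷ xs) a cd∈)) }) ,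
    λ { (refl , refl) → backwards cd∈ }
    where
    backwards : (b , a) ∉ zip (b ∷ e ∷ xs) (e ∷ xs ∷ʳ a)
    backwards (here refl) = Allₚ.All¬⇒¬Any a∉ (there (here refl))
    backwards (there ba∈) = Allₚ.All¬⇒¬Any b∉ (proj₁ (step-ends e xs a ba∈))

-- The edge set of a list of steps as a sum modulo 2, which makes degree parities additive.

link : ∀ {n} → Fin n → Fin n → Fin n → Fin n → Bool
link a b x y = (does (x ≟ a) ∧ does (y ≟ b)) xor (does (x ≟ b) ∧ does (y ≟ a))

toggles : ∀ {n} → List (Fin n × Fin n) → Fin n → Fin n → Bool
toggles []             x y = false
toggles ((a , b) ∷ es) x y = link a b x y xor toggles es x y

toggles-sym : ∀ {n} es (x y : Fin n) → toggles es x y ≡ toggles es y x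
toggles-sym []             x y = refl
toggles-sym ((a , b) ∷ es) x y = cong₂ _xor_
  (trans (xor-comm (does (x ≟ a) ∧ does (y ≟ b)) _)
         (cong₂ _xor_ (∧-comm (does (x ≟ b)) _) (∧-comm (does (x ≟ a)) _)))
  (toggles-sym es x y)

link-parity : ∀ {n} (a b x : Fin n) → parity (link a b x) ≡ does (x ≟ a) xor does (x ≟ b)
link-parity a b x = trans (parity-xor (λ y → does (x ≟ a) ∧ does (y ≟ b)) _)
                          (cong₂ _xor_ (term (does (x ≟ a)) b) (term (does (x ≟ b)) a))
  where
  term : ∀ c b → parity (λ y → c ∧ does (y ≟ b)) ≡ c
  term c b = begin
    parity (λ y → c ∧ does (y ≟ b))
      ≡⟨ parity-only _ b (λ y y≢b → trans (cong (c ∧_) (dec-false (y ≟ b) y≢b)) (∧-comm c false)) ⟩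
    c ∧ does (b ≟ b)                ≡⟨ cong (c ∧_) (dec-true (b ≟ b) refl) ⟩
    c ∧ true                        ≡⟨ ∧-comm c true ⟩
    c                               ∎
    where open ≡-Reasoning

-- The boundary of a walk modulo 2 is the sum of its two ends, since the contributions of inner
-- vertices telescope. For a closed walk it vanishes.
toggles-parity : ∀ {n} (a : Fin n) xs z x →
  parity (toggles (zip (a ∷ xs) (xs ∷ʳ z)) x) ≡ does (x ≟ a) xor does (x ≟ z)
toggles-parity a []       z x =
  trans (parity-cong λ y → xor-identityʳ (link a z x y)) (link-parity a z x)
toggles-parity a (b ∷ xs) z x = begin
  parity (λ y → link a b x y xor toggles (zip (b ∷ xs) (xs ∷ʳ z)) x y)
    ≡⟨ parity-xor (link a b x) _ ⟩
  parity (link a b x) xor parity (toggles (zip (b ∷ xs) (xs ∷ʳ z)) x)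
    ≡⟨ cong₂ _xor_ (link-parity a b x) (toggles-parity b xs z x) ⟩
  (does (x ≟ a) xor does (x ≟ b)) xor (does (x ≟ b) xor does (x ≟ z))
    ≡⟨ telescope (does (x ≟ a)) (does (x ≟ b)) (does (x ≟ z)) ⟩
  does (x ≟ a) xor does (x ≟ z) ∎
  where
  open ≡-Reasoning
  telescope : ∀ p q r → (p xor q) xor (q xor r) ≡ p xor r
  telescope p q r = begin
    (p xor q) xor (q xor r) ≡⟨ xor-assoc p q (q xor r) ⟩
    p xor (q xor (q xor r)) ≡⟨ cong (p xor_) (xor-assoc q q r) ⟨
    p xor ((q xor q) xor r) ≡⟨ cong (λ s → p xor (s xor r)) (xor-same q) ⟩
    p xor r                 ∎

xor⁻ : ∀ a {b} → T (a xor b) → T a ⊎ T b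
xor⁻ true  _ = inj₁ _
xor⁻ false p = inj₂ p

link⁻ : ∀ {n} (a b x y : Fin n) → T (link a b x y) → (x ≡ a × y ≡ b) ⊎ (x ≡ b × y ≡ a)
link⁻ a b x y p with xor⁻ (does (x ≟ a) ∧ does (y ≟ b)) p
... | inj₁ q = inj₁ (does⁻ (x ≟ a) (∧⁻ˡ (does (x ≟ a)) q) , does⁻ (y ≟ b) (∧⁻ʳ (does (x ≟ a)) q))
... | inj₂ q = inj₂ (does⁻ (x ≟ b) (∧⁻ˡ (does (x ≟ b)) q) , does⁻ (y ≟ a) (∧⁻ʳ (does (x ≟ b)) q))

link⁺ : ∀ {n} (a b : Fin n) → a ≢ b → link a b a b ≡ true
link⁺ a b a≢b rewrite dec-true (a ≟ a) refl | dec-true (b ≟ b) refl | dec-false (a ≟ b) a≢b = refl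

toggles⁻ : ∀ {n} es {x y : Fin n} → T (toggles es x y) → (x , y) ∈ es ⊎ (y , x) ∈ es
toggles⁻ ((a , b) ∷ es) {x} {y} p with xor⁻ (link a b x y) p
... | inj₂ q = [ inj₁ ∘ there , inj₂ ∘ there ]′ (toggles⁻ es q)
... | inj₁ q with link⁻ a b x y q
...   | inj₁ (refl , refl) = inj₁ (here refl)
...   | inj₂ (refl , refl) = inj₂ (here refl)

-- No other step gives the same edge, so nothing cancels it. Loops are excluded because the two
-- terms of `link a a` cancel each other.
toggles⁺ : ∀ {n} es {x y : Fin n} → AllPairs _#_ es → All (λ (a , b) → a ≢ b) es →
  (x , y) ∈ es → toggles es x y ≡ true
toggles⁺ ((a , b) ∷ es) (ab# ∷ _) (a≢b ∷ _) (here refl) =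
  cong₂ _xor_ (link⁺ a b a≢b) (¬T⇒≡ λ p →
    [ (λ ab∈ → proj₁ (All.lookup ab# ab∈) (refl , refl))
    , (λ ba∈ → proj₂ (All.lookup ab# ba∈) (refl , refl)) ]′ (toggles⁻ es p))
toggles⁺ ((a , b) ∷ es) {x} {y} (ab# ∷ es#) (_ ∷ loopless) (there xy∈) =
  cong₂ _xor_ (¬T⇒≡ λ p →
    [ (λ (x≡a , y≡b) → proj₁ (All.lookup ab# xy∈) (sym x≡a , sym y≡b))
    , (λ (x≡b , y≡a) → proj₂ (All.lookup ab# xy∈) (sym y≡a , sym x≡b)) ]′ (link⁻ a b x y p))
    (toggles⁺ es es# loopless xy∈)

InCycle⇒toggles : ∀ {n} {G : Graph (Fin n)} (C : Cycle G) {u v} → InCycle u v C → T (toggles (steps C) u v)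
InCycle⇒toggles {G = G} C {u} {v} = [ forwards , subst T (toggles-sym (steps C) v u) ∘ forwards ]′
  where
  open Cycle C
  forwards : ∀ {u v} → (u , v) ∈ steps C → T (toggles (steps C) u v)
  forwards uv∈ = subst T (sym (toggles⁺ (steps C) (cycle-steps-# start rest distinct (≤-pred length≥3))
    (All.map (Adj⇒≢ G) (linked⇒steps start rest start closed)) uv∈)) _

-- Splitting a graph into two edge-disjoint parts

module _ {n} (G : Graph (Fin n)) (M : Fin n → Fin n → Bool) (M-sym : ∀ u v → M u v ≡ M v u) where

  restrict : Graph (Fin n)
  restrict = record
    { adj        = λ u v → adj G u v ∧ M u v
    ; adj-sym    = λ u v → cong₂ _∧_ (adj-sym G u v) (M-sym u v)
    ; adj-irrefl = λ v → cong (_∧ M v v) (adj-irrefl G v)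
    }

  restrict⊆ : ∀ u v → Adj restrict u v → Adj G u v
  restrict⊆ u v = ∧⁻ˡ (adj G u v)

combine : ∀ {n} (G : Graph (Fin n)) M M-sym M′-sym →
  (D : CycleDecomposition (restrict G M M-sym))
  (D′ : CycleDecomposition (restrict G (λ u v → not (M u v)) M′-sym)) →
  Σ[ E ∈ CycleDecomposition G ] size E ≡ size D + size D′
combine G M M-sym M′-sym D D′ =
  record { cycles = map f (cycles D) ++ map f′ (cycles D′)
         ; disjoint = AllPairsₚ.++⁺ (AllPairsₚ.map⁺ (disjoint D)) (AllPairsₚ.map⁺ (disjoint D′))
             (Allₚ.map⁺ (All.universal (λ C → Allₚ.map⁺ (All.universal (cross C) _)) _))
         ; covers = cover } ,
  trans (length-++ (map f (cycles D))) (cong₂ _+_ (length-map f (cycles D)) (length-map f′ (cycles D′)))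
  where
  open CycleDecomposition
  H  = restrict G M M-sym
  H′ = restrict G (λ u v → not (M u v)) M′-sym
  f  = mapCycle {G = H} {G} (restrict⊆ G M M-sym)
  f′ = mapCycle {G = H′} {G} (restrict⊆ G _ M′-sym)

  cross : ∀ C C′ → EdgeDisjoint (f C) (f′ C′)
  cross C C′ u v uv∈ uv∈′ =
    not⁻ (M u v) (∧⁻ʳ (adj G u v) (InCycle⇒Adj C′ uv∈′)) (∧⁻ʳ (adj G u v) (InCycle⇒Adj C uv∈))

  cover : ∀ u v → Adj G u v → Any (InCycle u v) (map f (cycles D) ++ map f′ (cycles D′))
  cover u v uv with T? (M u v)
  ... | yes p = Anyₚ.++⁺ˡ (Anyₚ.map⁺ (covers D u v (∧⁺ uv p)))
  ... | no ¬p = Anyₚ.++⁺ʳ (map f (cycles D)) (Anyₚ.map⁺ (covers D′ u v (∧⁺ uv (not⁺ ¬p))))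

-- Construction of the decomposition

Supported : ∀ {n} → Graph (Fin n) → (Fin n → Bool) → Set
Supported G S = ∀ u v → Adj G u v → T (S u)

Decomposes : ∀ {n} → Graph (Fin n) → (Fin n → Bool) → Set
Decomposes G S = Σ[ D ∈ CycleDecomposition G ] size D + size D < count S

module _ {n} (G : Graph (Fin n)) (M : Fin n → Fin n → Bool)
  (M-sym : ∀ u v → M u v ≡ M v u) (M′-sym : ∀ u v → not (M u v) ≡ not (M v u)) where

  restrict-not-Even : Even G → Even (restrict G M M-sym) → Even (restrict G (λ u v → not (M u v)) M′-sym)
  restrict-not-Even even even₁ v = trans
    (cong (_xor parity (λ x → adj G v x ∧ not (M v x))) (sym (even₁ v)))
    (trans (sym (parity-split (adj G v) (M v))) (even v))

module RemoveCycle {n} (G : Graph (Fin n)) (even : Even G) (C : Cycle G) where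

  open Cycle C

  M : Fin n → Fin n → Bool
  M = toggles (steps C)

  M-sym  = toggles-sym (steps C)
  M′-sym : ∀ u v → not (M u v) ≡ not (M v u)
  M′-sym u v = cong not (M-sym u v)

  cyclePart   = restrict G M M-sym
  remainder   = restrict G (λ u v → not (M u v)) M′-sym

  C′ : Cycle cyclePart
  C′ = record
    { start = start ; rest = rest ; length≥3 = length≥3 ; distinct = distinct
    ; closed = steps⇒linked start rest start (All.tabulate λ uv∈ →
        ∧⁺ (InCycle⇒Adj C (inj₁ uv∈)) (InCycle⇒toggles C (inj₁ uv∈)))
    }

  single : CycleDecomposition cyclePart
  single = record
    { cycles = C′ ∷ [] ; disjoint = [] ∷ []
    ; covers = λ u v uv → here (toggles⁻ (steps C) (∧⁻ʳ (adj G u v) uv)) }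

  cyclePart-Even : Even cyclePart
  cyclePart-Even v = begin
    parity (λ x → adj G v x ∧ M v x)     ≡⟨ parity-cong pointwise ⟩
    parity (M v)                         ≡⟨ toggles-parity start rest start v ⟩
    does (v ≟ start) xor does (v ≟ start) ≡⟨ xor-same (does (v ≟ start)) ⟩
    false                                ∎
    where
    open ≡-Reasoning
    pointwise : ∀ x → adj G v x ∧ M v x ≡ M v x
    pointwise x with T? (M v x)
    ... | yes p = cong (_∧ M v x) (T⇒≡ (InCycle⇒Adj C (toggles⁻ (steps C) p)))
    ... | no ¬p rewrite ¬T⇒≡ ¬p = ∧-comm (adj G v x) false

  remainder-Even : Even remainder
  remainder-Even = restrict-not-Even G M M-sym M′-sym even cyclePart-Even

  -- The cycle uses at least two of the at most three edges at u; parity excludes one left.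
  remainder-isolated : ∀ u → count (adj G u) ≤ 3 → u ∈ start ∷ rest → ∀ x → ¬ Adj remainder u x
  remainder-isolated u low u∈ with w , uw∈ ← vertex-step start rest start u∈ =
    parity-small (adj remainder u) (remainder-Even u) (+-cancelˡ-≤ 2 _ 1 (begin
      2 + count (adj remainder u)                        ≤⟨ +-monoˡ-≤ _ 2≤ ⟩
      count (adj cyclePart u) + count (adj remainder u)  ≡⟨ count-split (adj G u) (M u) ⟨
      count (adj G u)                                    ≤⟨ low ⟩
      3                                                  ∎))
    where
    open ≤-Reasoning
    uw : Adj cyclePart u w
    uw = ∧⁺ (InCycle⇒Adj C (inj₁ uw∈)) (InCycle⇒toggles C (inj₁ uw∈))

    2≤ : 2 ≤ count (adj cyclePart u)
    2≤ with z , z≢w , uz ← parity-another (adj cyclePart u) (cyclePart-Even u) uw =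
      count-two (adj cyclePart u) uw uz z≢w

module Separate {n} (G : Graph (Fin n)) (S : Fin n → Bool) (even : Even G)
  (supported : Supported G S) (separation : Separation G S) where

  open Separation separation

  -- One end in `set` is enough: by `closed` the other end is then in `set` or is the cut vertex.
  M : Fin n → Fin n → Bool
  M u v = set u ∨ set v

  M-sym : ∀ u v → M u v ≡ M v u
  M-sym u v = ∨-comm (set u) (set v)

  M′-sym : ∀ u v → not (M u v) ≡ not (M v u)
  M′-sym u v = cong not (M-sym u v)

  near = restrict G M M-sym
  far  = restrict G (λ u v → not (M u v)) M′-sym

  nearSet farSet : Fin n → Bool
  nearSet x = S x ∧ (set x ∨ does (x ≟ cut))
  farSet  x = S x ∧ not (set x)

  near-Supported : Supported near nearSet
  near-Supported u v uv = ∧⁺ (supported u v uv′) (Equivalence.from T-∨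
    ([ inj₁ , (λ v∈ → [ inj₁ , inj₂ ∘ does⁺ (u ≟ cut) ]′ (closed v u v∈ (Adj-sym G uv′))) ]′
      (Equivalence.to (T-∨ {set u}) (∧⁻ʳ (adj G u v) uv))))
    where uv′ = ∧⁻ˡ (adj G u v) uv

  far-Supported : Supported far farSet
  far-Supported u v uv = ∧⁺ (supported u v (∧⁻ˡ (adj G u v) uv))
    (not⁺ λ u∈ → not⁻ (M u v) (∧⁻ʳ (adj G u v) uv) (Equivalence.from T-∨ (inj₁ u∈)))

  near-Even-off-cut : ∀ v → v ≢ cut → parity (adj near v) ≡ false
  near-Even-off-cut v v≢cut with T? (set v)
  ... | yes v∈ = trans (parity-cong λ x → trans (cong (λ b → adj G v x ∧ (b ∨ set x)) (T⇒≡ v∈))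
                                                (∧-comm (adj G v x) true))
                       (even v)
  ... | no  v∉ = parity-none (adj near v) λ x → ¬T⇒≡ λ vx →
    [ v∉ , (λ x∈ → [ v∉ , v≢cut ]′ (closed x v x∈ (Adj-sym G (∧⁻ˡ (adj G v x) vx)))) ]′
      (Equivalence.to (T-∨ {set v}) (∧⁻ʳ (adj G v x) vx))

  -- A vertex other than the cut vertex keeps all its edges or none. So only the cut vertex could
  -- have odd degree, and a graph cannot have exactly one odd vertex.
  near-Even : Even near
  near-Even v with v ≟ cut
  ... | no v≢cut = near-Even-off-cut v v≢cut
  ... | yes refl = trans (sym (parity-only (λ x → parity (adj near x)) v near-Even-off-cut))
                         (handshake (adj near) (adj-sym near) (adj-irrefl near))

  far-Even : Even far
  far-Even = restrict-not-Even G M M-sym M′-sym even near-Even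

  inside∈S : T (S inside)
  inside∈S = supported inside cut (Adj-sym G cut-edge)

  cut∈S : T (S cut)
  cut∈S = supported cut inside cut-edge

  near-smaller : count nearSet < count S
  near-smaller = subst (count nearSet <_) (sym (count-− S outside∈S))
    (s≤s (count-mono nearSet (S − outside) λ x x∈ → −⁺ S (∧⁻ˡ (S x) x∈) λ { refl →
      [ outside∉ , outside≢ ∘ does⁻ (outside ≟ cut) ]′ (Equivalence.to T-∨ (∧⁻ʳ (S x) x∈)) }))

  far-smaller : count farSet < count S
  far-smaller = subst (count farSet <_) (sym (count-− S inside∈S))
    (s≤s (count-mono farSet (S − inside) λ x x∈ → −⁺ S (∧⁻ˡ (S x) x∈) λ { refl →
      not⁻ (set x) (∧⁻ʳ (S x) x∈) inside∈ }))

  near-nonempty : 1 ≤ count nearSet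
  near-nonempty = count-pos nearSet (∧⁺ cut∈S (Equivalence.from T-∨ (inj₂ (does⁺ (cut ≟ cut) refl))))

  far-nonempty : 1 ≤ count farSet
  far-nonempty = count-pos farSet (∧⁺ cut∈S (not⁺ cut∉))

  -- The excess of one is the cut vertex, the only vertex in both sets.
  near+far≤ : count nearSet + count farSet ≤ suc (count S)
  near+far≤ = begin
    count nearSet + count farSet
      ≡⟨ cong (_+ count farSet) (count-split nearSet set) ⟩
    count (λ x → nearSet x ∧ set x) + count (λ x → nearSet x ∧ not (set x)) + count farSet
      ≤⟨ +-monoˡ-≤ (count farSet) (+-mono-≤ (count-mono _ (λ x → S x ∧ set x) inSet)
                                            (count-mono _ (λ x → does (x ≟ cut)) atCut)) ⟩
    count (λ x → S x ∧ set x) + count (λ x → does (x ≟ cut)) + count farSet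
      ≡⟨ cong (_+ count farSet) (trans (cong (count (λ x → S x ∧ set x) +_) (count-single cut))
                                       (+-comm _ 1)) ⟩
    suc (count (λ x → S x ∧ set x) + count farSet)
      ≡⟨ cong suc (count-split S set) ⟨
    suc (count S) ∎
    where
    open ≤-Reasoning
    inSet : ∀ x → T (nearSet x ∧ set x) → T (S x ∧ set x)
    inSet x p = ∧⁺ (∧⁻ˡ (S x) (∧⁻ˡ (nearSet x) p)) (∧⁻ʳ (nearSet x) p)

    atCut : ∀ x → T (nearSet x ∧ not (set x)) → T (does (x ≟ cut))
    atCut x p with Equivalence.to (T-∨ {set x}) (∧⁻ʳ (S x) (∧⁻ˡ (nearSet x) p))
    ... | inj₁ x∈ = contradiction x∈ (not⁻ (set x) (∧⁻ʳ (nearSet x) p))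
    ... | inj₂ q  = q

double-+ : ∀ {a b c d e} → a + a < c → b + b < d → c + d ≤ suc e → (a + b) + (a + b) < e
double-+ {a} {b} {c} {d} {e} a<c b<d c+d≤e = ≤-pred (begin
  suc (suc ((a + b) + (a + b)))  ≡⟨ cong (λ k → suc (suc k)) (interchange +-commutativeSemigroup a b a b) ⟩
  suc (suc ((a + a) + (b + b)))  ≡⟨ cong suc (+-suc (a + a) (b + b)) ⟨
  suc (a + a) + suc (b + b)      ≤⟨ +-mono-≤ a<c b<d ⟩
  c + d                          ≤⟨ c+d≤e ⟩
  suc e                          ∎)
  where open ≤-Reasoning

noEdges : ∀ {n} (G : Graph (Fin n)) → (∀ u v → ¬ Adj G u v) → CycleDecomposition G
noEdges G none = record
  { cycles = [] ; disjoint = [] ; covers = λ u v uv → contradiction uv (none u v) }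

decompose : ∀ {n} (G : Graph (Fin n)) (S : Fin n → Bool) → Acc _<_ (count S) →
  Even G → Sparse G → Supported G S → 1 ≤ count S → Decomposes G S
decompose {n} G S (acc smaller) even sparse supported nonempty
  with any? (λ a → any? λ b → T? (adj G a b))
-- The empty decomposition meets the strict bound because `S` is nonempty.
... | no  none = noEdges G (λ u v uv → none (u , v , uv)) , nonempty
... | yes (a , b , ab)
  with u , v , u≢v , Su , Sv , low-u , low-v ←
    sparse S (count-two S (supported a b ab) (supported b a (Adj-sym G ab)) (Adj⇒≢ G ab ∘ sym))
  with any? (λ y → T? (adj G u y))
...   | no isolated =
  let S≡ = count-− S Su
      D , D< = decompose G (S − u) (smaller (≤-reflexive (sym S≡))) even sparse
        (λ p q pq → −⁺ S (supported p q pq) λ { refl → isolated (q , pq) })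
        (count-pos (S − u) (−⁺ S Sv (u≢v ∘ sym)))
  in D , ≤-trans D< (≤-trans (n≤1+n _) (≤-reflexive (sym S≡)))
...   | yes (y , uy)
  -- Even degree gives `u` a second neighbour, needed to start a cycle at `u`.
  with z , z≢y , uz ← parity-another (adj G u) (even u) uy
  with through⊎separation G u v Su Sv u≢v (supported z u (Adj-sym G uz)) uy uz z≢y
...     | inj₂ separation =
  let open Separate G S even supported separation
      D , D<   = decompose near nearSet (smaller near-smaller) near-Even
        (Sparse-⊆ G near (restrict⊆ G M M-sym) sparse) near-Supported near-nonempty
      D′ , D′< = decompose far farSet (smaller far-smaller) far-Even
        (Sparse-⊆ G far (restrict⊆ G _ M′-sym) sparse) far-Supported far-nonempty
      E , E≡   = combine G M M-sym M′-sym D D′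
  in E , subst (λ k → k + k < count S) (sym E≡) (double-+ {size D} {size D′} D< D′< near+far≤)
...     | inj₁ through
  with C , u∈ , v∈ ← Through⇒Cycle G through =
  let open RemoveCycle G even C
      S′ = S − u − v
      S≡ : count S ≡ 2 + count S′
      S≡ = trans (count-− S Su) (cong suc (count-− (S − u) (−⁺ S Sv (u≢v ∘ sym))))
      D , D< = decompose remainder S′ (smaller (subst (count S′ <_) (sym S≡) (n≤1+n _)))
        remainder-Even (Sparse-⊆ G remainder (restrict⊆ G _ M′-sym) sparse)
        (λ p q pq → −⁺ (S − u) (−⁺ S (supported p q (restrict⊆ G _ M′-sym p q pq))
            λ { refl → remainder-isolated p (low p low-u) u∈ q pq })
            λ { refl → remainder-isolated p (low p low-v) v∈ q pq })
        third
      E , E≡ = combine G M M-sym M′-sym single D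
  in E , subst₂ (λ k c → k + k < c) (sym E≡) (sym S≡)
           (s≤s (subst (_< suc (count S′)) (sym (+-suc (size D) (size D))) (s≤s D<)))
  where
  -- `S` contains every neighbour of `p`, so the degree inside `S` is the full degree.
  low : ∀ p → count (λ x → adj G p x ∧ S x) ≤ 3 → count (adj G p) ≤ 3
  low p = ≤-trans (count-mono _ _ λ x px → ∧⁺ px (supported x p (Adj-sym G px)))

  neighbour∈ : ∀ {x} → Adj G u x → x ≢ v → T ((S − u − v) x)
  neighbour∈ {x} ux x≢v = −⁺ (S − u) (−⁺ S (supported x u (Adj-sym G ux)) (Adj⇒≢ G ux ∘ sym)) x≢v

  -- The recursive call needs a nonempty support: of the two neighbours `y` and `z` of `u`, at most
  -- one is `v`.
  third : 1 ≤ count (S − u − v)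
  third with y ≟ v
  ... | no  y≢v  = count-pos (S − u − v) (neighbour∈ uy y≢v)
  ... | yes refl = count-pos (S − u − v) (neighbour∈ uz z≢y)

-- Minimum decompositions

lookup-injective : ∀ {A : Set} {xs : List A} → Unique xs → Injective _≡_ _≡_ (lookup xs)
lookup-injective (_ ∷ _)      {zero}  {zero}  _  = refl
lookup-injective (x∉ ∷ _)     {zero}  {suc j} eq = contradiction eq (All.lookup x∉ (∈-lookup j))
lookup-injective (x∉ ∷ _)     {suc i} {zero}  eq = contradiction (sym eq) (All.lookup x∉ (∈-lookup i))
lookup-injective (_ ∷ unique) {suc i} {suc j} eq = cong suc (lookup-injective unique eq)

-- The finite search space, used twice: for the vertex lists of cycles and for lists of cycles.
words : ∀ {A : Set} → List A → ℕ → List (List A)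
words as zero    = [] ∷ []
words as (suc k) = [] ∷ cartesianProductWith _∷_ as (words as k)

∈-words : ∀ {A : Set} {as : List A} {k} xs → All (_∈ as) xs → length xs ≤ k → xs ∈ words as k
∈-words {k = zero}  []       _          _         = here refl
∈-words {k = suc k} []       _          _         = here refl
∈-words {k = suc k} (x ∷ xs) (x∈ ∷ xs∈) (s≤s len) =
  there (∈-cartesianProductWith⁺ _∷_ x∈ (∈-words xs xs∈ len))

module _ {n} (G : Graph (Fin n)) where

  open DecMembership (≡-dec (_≟_ {n}) (_≟_ {n})) using (_∈?_)

  InCycle? : ∀ u v (C : Cycle G) → Dec (InCycle u v C)
  InCycle? u v C = (u , v) ∈? steps C ⊎-dec (v , u) ∈? steps C

  edgeDisjoint? : ∀ (C D : Cycle G) → Dec (EdgeDisjoint C D)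
  edgeDisjoint? C D = all? λ u → all? λ v → InCycle? u v C →-dec ¬? (InCycle? u v D)

  IsDecomposition : List (Cycle G) → Set
  IsDecomposition Cs = AllPairs EdgeDisjoint Cs × (∀ u v → Adj G u v → Any (InCycle u v) Cs)

  isDecomposition? : ∀ Cs → Dec (IsDecomposition Cs)
  isDecomposition? Cs = AllPairs.allPairs? edgeDisjoint? Cs ×-dec
    all? λ u → all? λ v → T? (adj G u v) →-dec Any.any? (InCycle? u v) Cs

  IsCycle : Fin n × List (Fin n) → Set
  IsCycle (s , r) = 3 ≤ length (s ∷ r) × Unique (s ∷ r) × Linked (Adj G) (s ∷ r ∷ʳ s)

  isCycle? : ∀ sr → Dec (IsCycle sr)
  isCycle? (s , r) = 3 ≤? length (s ∷ r) ×-dec unique? _≟_ (s ∷ r) ×-dec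
    Linked.linked? (λ u v → T? (adj G u v)) (s ∷ r ∷ʳ s)

  toCycles : ∀ sr → Dec (IsCycle sr) → List (Cycle G)
  toCycles (s , r) (yes (long , distinct , closed)) =
    record { start = s ; rest = r ; length≥3 = long ; distinct = distinct ; closed = closed } ∷ []
  toCycles _       (no _) = []

  -- The decision procedure may return other proofs than those stored in `C`; all three conditions
  -- are proof-irrelevant, so the cycles are equal.
  ∈-toCycles : ∀ C (d : Dec (IsCycle (Cycle.start C , Cycle.rest C))) → C ∈ toCycles _ d
  ∈-toCycles C (no ¬c) = contradiction (length≥3 , distinct , closed) ¬c
    where open Cycle C
  ∈-toCycles C (yes (long , unique , linked))
    rewrite ≤-irrelevant long (Cycle.length≥3 C)
          | AllPairs.irrelevant (λ _ _ → refl) unique (Cycle.distinct C)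
          | Linked.irrelevant T-irrelevant linked (Cycle.closed C) = here refl

  allCycles : List (Cycle G)
  allCycles = concatMap (λ sr → toCycles sr (isCycle? sr))
                        (cartesianProduct (allFin n) (words (allFin n) n))

  ∈-allCycles : ∀ C → C ∈ allCycles
  ∈-allCycles C = ∈-concatMap⁺ (λ sr → toCycles sr (isCycle? sr))
    (Any.map (λ { refl → ∈-toCycles C (isCycle? _) })
      (∈-cartesianProduct⁺ (∈-allFin start)
        (∈-words rest (All.universal ∈-allFin rest)
          (≤-trans (n≤1+n _) (injective⇒≤ (lookup-injective distinct))))))
    where open Cycle C

  smallDecomposition? : ∀ k → Dec (Σ[ D ∈ CycleDecomposition G ] size D ≤ k)
  smallDecomposition? k =
    map′ found search (Any.any? (λ Cs → isDecomposition? Cs ×-dec length Cs ≤? k) (words allCycles k))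
    where
    found : Any (λ Cs → IsDecomposition Cs × length Cs ≤ k) (words allCycles k) →
      Σ[ D ∈ CycleDecomposition G ] size D ≤ k
    found p with Cs , (disjoint , covers) , len ← Any.satisfied p =
      record { cycles = Cs ; disjoint = disjoint ; covers = covers } , len

    search : Σ[ D ∈ CycleDecomposition G ] size D ≤ k →
      Any (λ Cs → IsDecomposition Cs × length Cs ≤ k) (words allCycles k)
    search (D , len) = Any.map (λ { refl → (disjoint , covers) , len })
      (∈-words cycles (All.universal ∈-allCycles cycles) len)
      where open CycleDecomposition D

  -- Lower the bound as long as a smaller decomposition exists, which finite search decides. Once
  -- none of size at most `k` is left, a decomposition of size at most `suc k` is minimum.
  minimumDecomposition : ∀ k (D : CycleDecomposition G) → size D ≤ k → ∃[ c ] IsCn G c × c ≤ k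
  minimumDecomposition zero D D≤0 = size D , record
    { attained = D , refl ; minimal = λ _ → subst (_≤ _) (sym (n≤0⇒n≡0 D≤0)) z≤n } , D≤0
  minimumDecomposition (suc k) D D≤ with smallDecomposition? k
  ... | yes (D′ , D′≤k) with c , cn , c≤k ← minimumDecomposition k D′ D′≤k = c , cn , m≤n⇒m≤1+n c≤k
  ... | no  none = size D , record
    { attained = D , refl
    ; minimal  = λ D′ → ≤-trans D≤ (≰⇒> λ D′≤k → none (D′ , D′≤k)) } , D≤

theorem3p5 : ∀ (n : ℕ) (G : Graph (Fin n)) →
    Connected G → Eulerian G → PartialKTree 3 G →
    ∃[ c ] (IsCn G c × c ≤ ⌊ n ∸ 1 /2⌋)
theorem3p5 n G (v , _) eulerian partial
  with D , D< ← decompose G (λ _ → true) (<-wellFounded _) (Eulerian⇒Even G eulerian)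
                  (partial3Tree⇒Sparse {G = G} partial) (λ _ _ _ → _) (count-pos (λ _ → true) {v} _) =
  minimumDecomposition G ⌊ n ∸ 1 /2⌋ D (begin
    size D                       ≡⟨ n≡⌊n+n/2⌋ (size D) ⟩
    ⌊ size D + size D /2⌋        ≤⟨ ⌊n/2⌋-mono (≤-pred (≤-trans D< (≤-reflexive count≡))) ⟩
    ⌊ n ∸ 1 /2⌋                  ∎)
  where
  open ≤-Reasoning
  -- The vertex `v` makes `n` positive, so the truncated `n ∸ 1` is its true predecessor.
  count≡ : count {n} (λ _ → true) ≡ suc (n ∸ 1)
  count≡ = trans (count-all n) (sym (suc-∸1 v))
    where
    suc-∸1 : ∀ {n} → Fin n → suc (n ∸ 1) ≡ n
    suc-∸1 {suc n} _ = refl
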